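{- Let $\delta,\alpha \ge 1$. Let $X$ be a $\delta$-dense multi-set of size $n$ that has no $\alpha$-almost divisor. Then there exists a subset $R\subseteq X$ such that (i) $|R| \le |X|\cdot 8\alpha\log(2n)/\delta$, (ii) $\Sigma(R) \le \Sigma(X)\cdot 8\alpha\log(2n)/\delta$, and (iii) for any integer $1 < d \le \alpha\cdot\mu_X\,\Sigma(X)/n^2$ the multi-set $R$ contains at least $d$ numbers not divisible by $d$, that is, $|\overline{R(d)}|\ge d$.
   Context: For a finite non-empty multi-set $X$ of positive integers: $|X|$ is the number of elements counted with multiplicity, $\max(X)$ its maximum element, $\mu_X$ the largest multiplicity of any number in $X$, $\Sigma(X)$ the sum of all elements (with multiplicity). $X$ is $\delta$-dense if $|X|^2\ge\delta\cdot\mu_X\cdot\max(X)$. For an integer $d$, $X(d) := X\cap d\mathbb{Z}$ and $\overline{X(d)} := X\setminus X(d)$ (same notation for $R$). An integer $d>1$ is an $\alpha$-almost divisor of $X$ if $|\overline{X(d)}|\le\alpha\cdot\mu_X\cdot\Sigma(X)/|X|^2$. A subset $R\subseteq X$ of a multi-set respects multiplicities.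
   Formalization: The parameters δ and α are taken to be rational numbers (at least 1) instead of real numbers; log is read as the natural logarithm. -}

module Defs where

open import Data.Nat as ℕ using (ℕ; zero; suc; _⊔_)
open import Data.Nat.Divisibility using (_∣?_)
open import Data.Integer using (+_)
open import Data.Rational using (ℚ; _+_; _*_; _/_; _≤_; 1ℚ)
open import Data.List using (List; []; _∷_; length; filter; foldr)
open import Data.Nat.ListAction using (sum)
open import Relation.Nullary.Decidable using (¬?)
open import Relation.Binary.PropositionalEquality using (_≡_)

-- A finite multi-set of positive integers is represented by a list of naturals
-- (order irrelevant; positivity and non-emptiness are hypotheses of the theorem).
-- A sub-multi-set R ⊆ X (respecting multiplicities) is a sublist of X.

toℚ : ℕ → ℚ
toℚ n = + n / 1

count : ℕ → List ℕ → ℕ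
count x X = length (filter (ℕ._≟ x) X)

mult : List ℕ → ℕ
mult X = foldr (λ x m → count x X ⊔ m) 0 X

maxL : List ℕ → ℕ
maxL = foldr _⊔_ 0

Σ : List ℕ → ℕ
Σ = sum

nonMultiples : ℕ → List ℕ → List ℕ
nonMultiples d X = filter (λ x → ¬? (d ∣? x)) X

Dense : ℚ → List ℕ → Set
Dense δ X = δ * toℚ (mult X) * toℚ (maxL X) ≤ toℚ (length X ℕ.* length X)

-- d is an α-almost divisor of X :
--   d > 1  and  |\overline{X(d)}| ≤ α · μ_X · Σ(X) / |X|^2
-- (the inequality is stated multiplied through by |X|^2 > 0)
AlmostDivisor : ℚ → List ℕ → ℕ → Set
AlmostDivisor α X d =
  (1 ℕ.< d) ×' (toℚ (length (nonMultiples d X)) * toℚ (length X ℕ.* length X)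
                 ≤ α * toℚ (mult X) * toℚ (Σ X))
  where
  open import Data.Product using () renaming (_×_ to _×'_)

expTerm : ℚ → ℕ → ℚ
expTerm t zero    = 1ℚ
expTerm t (suc k) = expTerm t k * t * (+ 1 / suc k)

expPartial : ℚ → ℕ → ℚ
expPartial t zero    = 1ℚ
expPartial t (suc N) = expPartial t N + expTerm t (suc N)

-- a ≤ c · ln m   (natural logarithm), for a ≥ 0 and c > 0.
-- With t = a / c (i.e. t · c = a) this says t ≤ ln m, i.e. e^t ≤ m, i.e. every
-- partial sum of the exponential series at t (t ≥ 0) is at most m.
LeMulLn : ℚ → ℚ → ℕ → Set
LeMulLn a c m = ∀ (t : ℚ) → t * c ≡ a → ∀ (N : ℕ) → expPartial t N ≤ toℚ m

{-# OPTIONS --safe #-}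

-- Let b = ⌊α μ Σ(X) / n²⌋. Density makes any b elements of X cheap: b ≤ α n / δ, and their
-- sum is at most b max(X) ≤ α Σ(X) / δ; hence any R of size at most 8 b ln(2n) is small enough.
-- Start from any 2b elements of X (if n < 2b, then R = X will do). A number d ≤ b can only fail for this sample if each of
-- its prime factors p divides more than half of the sample. As max(X) ≤ n², counting
-- prime divisors leaves at most 4 log₂ n such p; since no p is an almost divisor, X has
-- b non-multiples of each of them, and adding these to the sample gives R.
--
-- Logarithms are replaced by the L with n < 2ᴸ ≤ 2n, for which |R| ≤ 5 L b, and the
-- comparison with 8 ln(2n) comes down to e^(5/8) ≤ 2.
module Submission where

open import Defs
open import Data.Nat as ℕ using (ℕ; zero; suc; _<_; z≤n; s≤s)
import Data.Nat.Coprimality as Coprimality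
open import Data.Nat.Divisibility using (_∣_; _∣?_; divides; ∣-trans; ∣⇒≤; m∣m*n)
open import Data.Nat.ListAction using (sum)
open import Data.Nat.Primality using (Prime; prime?; euclidsLemma; prime⇒irreducible; prime⇒nonTrivial; ¬prime[1])
open import Data.Nat.Primality.Factorisation using (factorise)
import Data.Nat.Properties as ℕP
import Data.Nat.Solver as ℕSolver
import Data.Integer as ℤ
import Data.Integer.Properties as ℤP
import Data.Rational.Unnormalised as ℚᵘ
import Data.Rational.Unnormalised.Properties as ℚᵘP
open import Data.Empty using (⊥-elim)
open import Data.List using (List; []; _∷_; length; filter; take; map; upTo)
open import Data.List.Properties using (length-take; length-filter; filter-all; filter-accept)
open import Data.List.Membership.Propositional.Properties using (∈-filter⁺; ∈-upTo⁺)
open import Data.List.Relation.Unary.All as All using (All; []; _∷_)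
import Data.List.Relation.Unary.All.Properties as AllP
open import Data.List.Relation.Unary.AllPairs using ([]; _∷_)
open import Data.List.Relation.Unary.Unique.Propositional using (Unique)
import Data.List.Relation.Unary.Unique.Propositional.Properties as UniqueP
open import Data.List.Relation.Binary.Sublist.Propositional using (_⊆_; []; _∷_; _∷ʳ_; ⊆-refl; ⊆-trans; minimum)
open import Data.List.Relation.Binary.Sublist.Propositional.Properties using (take-⊆; filter-⊆; filter⁺; length-mono-≤; All-resp-⊆)
open import Data.Product using (Σ-syntax; ∃-syntax; _×_; _,_; proj₁)
open import Data.Sum using (inj₁; inj₂)
open import Relation.Nullary using (¬_; Dec; yes; no)
open import Relation.Nullary.Decidable using (¬?; _×-dec_)
open import Relation.Unary using (Decidable)
open import Relation.Binary.PropositionalEquality using (_≡_; refl; sym; trans; cong; cong₂; subst; subst₂)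

module Combinatorics where
  open import Data.Nat using (_≤_; _+_; _*_; _^_)
  open ℕSolver.+-*-Solver using (solve; _:+_; _:*_; _:=_; con)

  -- Prime divisors of an integer.

  prime-divisor : ∀ {d} → 1 < d → ∃[ p ] (Prime p × p ∣ d)
  prime-divisor {d@(suc _)} 1<d with factorise d
  ... | record { factors = []     ; isFactorisation = eq } = ⊥-elim (ℕP.<-irrefl (sym eq) 1<d)
  ... | record { factors = p ∷ ps ; isFactorisation = eq ; factorsPrime = pp ∷ _ } =
    p , pp , subst (p ∣_) (sym eq) (m∣m*n _)

  prime⇒>1 : ∀ {p} → Prime p → 1 < p
  prime⇒>1 {p} pp = ℕ.nonTrivial⇒n>1 p {{prime⇒nonTrivial pp}}

  prime-∣-prime : ∀ {p q} → Prime p → Prime q → p ∣ q → p ≡ q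
  prime-∣-prime pp pq p∣q with prime⇒irreducible pq p∣q
  ... | inj₁ refl = ⊥-elim (¬prime[1] pp)
  ... | inj₂ eq   = eq

  -- Write x = q p. The other primes of P differ from p, so by Euclid's lemma they divide q, and
  -- induction applies to q; the prime p contributes a factor of at least 2.
  primeDivisors-bound : ∀ {P x} → Unique P → All Prime P → All (_∣ x) P → 0 < x → 2 ^ length P ≤ x
  primeDivisors-bound [] [] [] 0<x = 0<x
  primeDivisors-bound {p ∷ P} {x} (p∉P ∷ uP) (pp ∷ pP) (divides q refl ∷ P∣x) 0<x = begin
    2 * 2 ^ length P ≤⟨ ℕP.*-mono-≤ (prime⇒>1 pp) (primeDivisors-bound uP pP P∣q 0<q) ⟩
    p * q            ≡⟨ ℕP.*-comm p q ⟩
    q * p            ∎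
    where
    open ℕP.≤-Reasoning
    0<q : 0 < q
    0<q = ℕP.n≢0⇒n>0 λ { refl → ℕP.<-irrefl refl 0<x }
    ∣q : ∀ {r} → ¬ p ≡ r × Prime r × r ∣ q * p → r ∣ q
    ∣q (p≢r , pr , r∣qp) with euclidsLemma q p pr r∣qp
    ... | inj₁ r∣q = r∣q
    ... | inj₂ r∣p = ⊥-elim (p≢r (sym (prime-∣-prime pr pp r∣p)))
    P∣q : All (_∣ q) P
    P∣q = All.map ∣q (All.zip (p∉P , All.zip (pP , P∣x)))

  -- Double counting of the pairs (p, y) with p ∣ y.

  multiples : ℕ → List ℕ → List ℕ
  multiples d X = filter (d ∣?_) X

  divisorsIn : List ℕ → ℕ → List ℕ
  divisorsIn P x = filter (_∣? x) P

  multiples+nonMultiples : ∀ d X → length (multiples d X) + length (nonMultiples d X) ≡ length X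
  multiples+nonMultiples d [] = refl
  multiples+nonMultiples d (x ∷ X) with d ∣? x
  ... | yes _ = cong suc (multiples+nonMultiples d X)
  ... | no  _ = trans (ℕP.+-suc _ _) (cong suc (multiples+nonMultiples d X))

  incidences-∷ : ∀ x P Y → sum (map (λ p → length (multiples p (x ∷ Y))) P)
    ≡ length (divisorsIn P x) + sum (map (λ p → length (multiples p Y)) P)
  incidences-∷ x [] Y = refl
  incidences-∷ x (p ∷ P) Y rewrite incidences-∷ x P Y with p ∣? x
  ... | yes _ = cong suc (solve 3 (λ a b c → a :+ (b :+ c) := b :+ (a :+ c)) refl (length (multiples p Y)) (length (divisorsIn P x)) _)
  ... | no  _ = solve 3 (λ a b c → a :+ (b :+ c) := b :+ (a :+ c)) refl (length (multiples p Y)) (length (divisorsIn P x)) _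

  -- The sum counts pairs (p, y) with p in P, y in Y and p ∣ y. Grouping them by y instead,
  -- `primeDivisors-bound` shows that each y contributes a factor of at most y ≤ M to the power of
  -- 2.
  incidences-bound : ∀ {P M} → Unique P → All Prime P → ∀ {Y} → All (0 <_) Y → All (_≤ M) Y →
    2 ^ sum (map (λ p → length (multiples p Y)) P) ≤ M ^ length Y
  incidences-bound {P} uP pP [] [] = ℕP.≤-reflexive (cong (2 ^_) (sum-0 P))
    where
    sum-0 : ∀ P → sum (map (λ p → length (multiples p [])) P) ≡ 0
    sum-0 []      = refl
    sum-0 (_ ∷ P) = sum-0 P
  incidences-bound {P} {M} uP pP {x ∷ Y} (0<x ∷ 0<Y) (x≤M ∷ Y≤M) = begin
    2 ^ sum (map (λ p → length (multiples p (x ∷ Y))) P)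
      ≡⟨ cong (2 ^_) (incidences-∷ x P Y) ⟩
    2 ^ (length (divisorsIn P x) + s)
      ≡⟨ ℕP.^-distribˡ-+-* 2 (length (divisorsIn P x)) s ⟩
    2 ^ length (divisorsIn P x) * 2 ^ s
      ≤⟨ ℕP.*-mono-≤ (ℕP.≤-trans (primeDivisors-bound (UniqueP.filter⁺ (_∣? x) uP) (AllP.filter⁺ (_∣? x) pP) (AllP.all-filter (_∣? x) P) 0<x) x≤M)
                     (incidences-bound uP pP 0<Y Y≤M) ⟩
    M * M ^ length Y ∎
    where
    open ℕP.≤-Reasoning
    s = sum (map (λ p → length (multiples p Y)) P)

  sum-map-≥ : ∀ {b} (f : ℕ → ℕ) {P} → All (λ p → b ≤ f p) P → length P * b ≤ sum (map f P)
  sum-map-≥ f []         = z≤n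
  sum-map-≥ f (b≤ ∷ bs) = ℕP.+-mono-≤ b≤ (sum-map-≥ f bs)

  -- Non-multiples along sublists.

  _∤?_ : ∀ d x → Dec (¬ d ∣ x)
  d ∤? x = ¬? (d ∣? x)

  nonMultiples-mono : ∀ d {X Y} → X ⊆ Y → length (nonMultiples d X) ≤ length (nonMultiples d Y)
  nonMultiples-mono d X⊆Y = length-mono-≤ (filter⁺ (d ∤?_) (d ∤?_) (λ { refl ¬d → ¬d }) X⊆Y)

  nonMultiples-∣ : ∀ {p d} → p ∣ d → ∀ X → length (nonMultiples p X) ≤ length (nonMultiples d X)
  nonMultiples-∣ {p} {d} p∣d X = length-mono-≤ (filter⁺ (p ∤?_) (d ∤?_) (λ { refl ¬p d∣ → ¬p (∣-trans p∣d d∣) }) (⊆-refl {x = X}))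

  -- The union is formed by positions in X: a position used by both A and B is kept once, so C never
  -- exceeds the multiplicities of X.
  ⊆-union : ∀ {A B X : List ℕ} → A ⊆ X → B ⊆ X →
    ∃[ C ] (C ⊆ X × A ⊆ C × B ⊆ C × length C ≤ length A + length B)
  ⊆-union [] [] = [] , [] , [] , [] , z≤n
  ⊆-union (x ∷ʳ A⊆) (_ ∷ʳ B⊆) with ⊆-union A⊆ B⊆
  ... | C , C⊆ , A⊆C , B⊆C , le = C , x ∷ʳ C⊆ , A⊆C , B⊆C , le
  ⊆-union (_∷_ {x = x} refl A⊆) (_ ∷ʳ B⊆) with ⊆-union A⊆ B⊆
  ... | C , C⊆ , A⊆C , B⊆C , le = x ∷ C , refl ∷ C⊆ , refl ∷ A⊆C , x ∷ʳ B⊆C , s≤s le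
  ⊆-union (x ∷ʳ A⊆) (refl ∷ B⊆) with ⊆-union A⊆ B⊆
  ... | C , C⊆ , A⊆C , B⊆C , le = x ∷ C , refl ∷ C⊆ , x ∷ʳ A⊆C , refl ∷ B⊆C ,
    ℕP.≤-trans (s≤s le) (ℕP.≤-reflexive (sym (ℕP.+-suc _ _)))
  ⊆-union (_∷_ {x = x} refl A⊆) (refl ∷ B⊆) with ⊆-union A⊆ B⊆
  ... | C , C⊆ , A⊆C , B⊆C , le = x ∷ C , refl ∷ C⊆ , refl ∷ A⊆C , refl ∷ B⊆C ,
    s≤s (ℕP.≤-trans le (ℕP.+-monoʳ-≤ _ (ℕP.n≤1+n _)))

  -- For each p, b of its non-multiples in X are united with the list built so far. Primes already
  -- treated stay good, since enlarging a list never lowers its number of non-multiples.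
  add-nonMultiples : ∀ {X A} b → A ⊆ X → ∀ P → All (λ p → b ≤ length (nonMultiples p X)) P →
    ∃[ C ] (C ⊆ X × A ⊆ C × length C ≤ length A + length P * b × All (λ p → b ≤ length (nonMultiples p C)) P)
  add-nonMultiples {X} {A} b A⊆X [] [] = A , A⊆X , ⊆-refl , ℕP.m≤m+n _ _ , []
  add-nonMultiples {X} {A} b A⊆X (p ∷ P) (b≤ ∷ bs)
    with C , C⊆X , A⊆C , |C|≤ , good ← add-nonMultiples b A⊆X P bs
    with D , D⊆X , C⊆D , B⊆D , |D|≤ ← ⊆-union C⊆X (⊆-trans (take-⊆ b (nonMultiples p X)) (filter-⊆ (p ∤?_) X))
    = D , D⊆X , ⊆-trans A⊆C C⊆D , |D|≤′
    , ℕP.≤-trans (ℕP.≤-reflexive (sym |nonMultiples-B|)) (nonMultiples-mono p B⊆D)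
    ∷ All.map (λ {q} le → ℕP.≤-trans le (nonMultiples-mono q C⊆D)) good
    where
    B = take b (nonMultiples p X)
    |B| : length B ≡ b
    |B| = trans (length-take b (nonMultiples p X)) (ℕP.m≤n⇒m⊓n≡m b≤)
    |nonMultiples-B| : length (nonMultiples p B) ≡ b
    |nonMultiples-B| = trans (cong length (filter-all (p ∤?_) (AllP.take⁺ b (AllP.all-filter (p ∤?_) X)))) |B|
    |D|≤′ : length D ≤ length A + (b + length P * b)
    |D|≤′ = begin
      length D                       ≤⟨ |D|≤ ⟩
      length C + length B            ≤⟨ ℕP.+-mono-≤ |C|≤ (ℕP.≤-reflexive |B|) ⟩
      length A + length P * b + b    ≡⟨ solve 3 (λ a c b → a :+ c :+ b := a :+ (b :+ c)) refl (length A) (length P * b) b ⟩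
      length A + (b + length P * b)  ∎
      where open ℕP.≤-Reasoning

  -- Bad primes of a sample, and the selection of R.

  badPrime? : ∀ b Y p → Dec (Prime p × length (nonMultiples p Y) < b)
  badPrime? b Y p = prime? p ×-dec (length (nonMultiples p Y) ℕP.<? b)

  -- The range stops at b because R only has to serve 1 < d ≤ b, whose prime divisors are at most b.
  badPrimes : ℕ → List ℕ → List ℕ
  badPrimes b Y = filter (badPrime? b Y) (upTo (suc b))

  -- Each element of Y has at most log₂ M prime divisors, and a bad prime divides at least half
  -- of the elements; comparing 2 ^ (number of incidences) with M ^ |Y| avoids the logarithm.
  length-badPrimes : ∀ {b L M Y} → 0 < b → length Y ≡ 2 * b → All (0 <_) Y → All (_≤ M) Y →
    M < 2 ^ (2 * L) → length (badPrimes b Y) < 4 * L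
  length-badPrimes {b@(suc _)} {L} {M} {Y} 0<b |Y| 0<Y Y≤M M< =
    ℕP.*-cancelʳ-< b (length P) (4 * L) (ℕP.≰⇒> λ 4Lb≤ → ℕP.<-irrefl refl (begin-strict
      2 ^ (length P * b)                                       ≤⟨ ℕP.^-monoʳ-≤ 2 (sum-map-≥ _ (All.map enough (AllP.all-filter (badPrime? b Y) (upTo (suc b))))) ⟩
      2 ^ sum (map (λ p → length (multiples p Y)) P)           ≤⟨ incidences-bound uP pP 0<Y Y≤M ⟩
      M ^ length Y                                             ≡⟨ cong (M ^_) |Y| ⟩
      -- The strict step: the exponent is non-zero because b is matched as a successor.
      M ^ (2 * b)                                              <⟨ ℕP.^-monoˡ-< (2 * b) M< ⟩
      (2 ^ (2 * L)) ^ (2 * b)                                  ≡⟨ ℕP.^-*-assoc 2 (2 * L) (2 * b) ⟩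
      2 ^ (2 * L * (2 * b))                                    ≡⟨ cong (2 ^_) (solve 2 (λ l b → con 2 :* l :* (con 2 :* b) := con 4 :* l :* b) refl L b) ⟩
      2 ^ (4 * L * b)                                          ≤⟨ ℕP.^-monoʳ-≤ 2 4Lb≤ ⟩
      2 ^ (length P * b)                                       ∎))
    where
    open ℕP.≤-Reasoning
    P = badPrimes b Y
    uP : Unique P
    uP = UniqueP.filter⁺ (badPrime? b Y) (UniqueP.upTo⁺ (suc b))
    pP : All Prime P
    pP = All.map proj₁ (AllP.all-filter (badPrime? b Y) (upTo (suc b)))
    -- Of the 2b entries of Y fewer than b are non-multiples of a bad p, which leaves at least b
    -- multiples.
    enough : ∀ {p} → Prime p × length (nonMultiples p Y) < b → b ≤ length (multiples p Y)
    enough {p} (_ , few) = ℕP.+-cancelʳ-≤ b b _ (begin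
      b + b                                                  ≡⟨ cong (b +_) (ℕP.+-identityʳ b) ⟨
      2 * b                                                  ≡⟨ |Y| ⟨
      length Y                                               ≡⟨ multiples+nonMultiples p Y ⟨
      length (multiples p Y) + length (nonMultiples p Y)     ≤⟨ ℕP.+-monoʳ-≤ (length (multiples p Y)) (ℕP.<⇒≤ few) ⟩
      length (multiples p Y) + b                             ∎)

  -- It is enough that R contains b non-multiples of every prime p ≤ b: a d with 1 < d ≤ b has such
  -- a prime divisor p, and non-multiples of p are non-multiples of d. The hypothesis on X
  -- guarantees that the missing ones can be found there.
  selection : ∀ {X M} b L → 0 < L → All (0 <_) X → All (_≤ M) X → M < 2 ^ (2 * L) →
    (∀ p → 1 < p → b ≤ length (nonMultiples p X)) →
    ∃[ R ] (R ⊆ X × length R ≤ 5 * L * b × (∀ d → 1 < d → d ≤ b → d ≤ length (nonMultiples d R)))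
  selection zero L 0<L 0<X X≤M M< large = [] , minimum _ , z≤n , λ { d 1<d z≤n → z≤n }
  selection {X} {M} b@(suc _) L 0<L 0<X X≤M M< large with 2 * b ℕP.≤? length X
  ... | no 2b≰n = X , ⊆-refl , |X|≤ , λ d 1<d d≤b → ℕP.≤-trans d≤b (large d 1<d)
    where
    open ℕP.≤-Reasoning
    |X|≤ : length X ≤ 5 * L * b
    |X|≤ = begin
      length X  ≤⟨ ℕP.<⇒≤ (ℕP.≰⇒> 2b≰n) ⟩
      2 * b     ≤⟨ ℕP.*-monoˡ-≤ b (ℕP.*-mono-≤ {2} {5} (s≤s (s≤s z≤n)) 0<L) ⟩
      5 * L * b ∎
  ... | yes 2b≤n
    with R , R⊆X , Y⊆R , |R|≤ , good ← add-nonMultiples b (take-⊆ (2 * b) X) (badPrimes b (take (2 * b) X))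
      (All.map (λ {p} (pp , _) → large p (prime⇒>1 pp)) (AllP.all-filter (badPrime? b (take (2 * b) X)) (upTo (suc b))))
    = R , R⊆X , |R|≤′ , λ d 1<d d≤b → covered d d≤b (prime-divisor 1<d)
    where
    Y = take (2 * b) X
    |Y| : length Y ≡ 2 * b
    |Y| = trans (length-take (2 * b) X) (ℕP.m≤n⇒m⊓n≡m 2b≤n)
    |R|≤′ : length R ≤ 5 * L * b
    |R|≤′ = begin
      length R                                ≤⟨ |R|≤ ⟩
      length Y + length (badPrimes b Y) * b   ≡⟨ cong (_+ length (badPrimes b Y) * b) |Y| ⟩
      2 * b + length (badPrimes b Y) * b      ≡⟨ ℕP.*-distribʳ-+ b 2 (length (badPrimes b Y)) ⟨
      -- The 2 is split as 1 + 1: one unit is covered by 1 ≤ L, the other by the strict inequality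
      -- in `length-badPrimes`, giving L + 4 L.
      (2 + length (badPrimes b Y)) * b        ≤⟨ ℕP.*-monoˡ-≤ b (ℕP.+-mono-≤ 0<L (length-badPrimes {L = L} (s≤s z≤n) |Y| (AllP.take⁺ (2 * b) 0<X) (AllP.take⁺ (2 * b) X≤M) M<)) ⟩
      5 * L * b                               ∎
      where open ℕP.≤-Reasoning
    -- A bad prime has been repaired by the added elements; any other prime already has b
    -- non-multiples in Y ⊆ R.
    large-R : ∀ {p} → Prime p → p ≤ b → b ≤ length (nonMultiples p R)
    large-R {p} pp p≤b with length (nonMultiples p Y) ℕP.<? b
    ... | yes few = All.lookup good (∈-filter⁺ (badPrime? b Y) (∈-upTo⁺ (s≤s p≤b)) (pp , few))
    ... | no ¬few = ℕP.≤-trans (ℕP.≮⇒≥ ¬few) (nonMultiples-mono p Y⊆R)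
    covered : ∀ d → d ≤ b → ∃[ p ] (Prime p × p ∣ d) → d ≤ length (nonMultiples d R)
    covered zero      _   _              = z≤n
    covered d@(suc _) d≤b (p , pp , p∣d) = ℕP.≤-trans d≤b
      (ℕP.≤-trans (large-R pp (ℕP.≤-trans (∣⇒≤ p∣d) d≤b)) (nonMultiples-∣ p∣d R))

  -- Binary logarithm, bounded search, and bounds for lists.

  ∃-log : ∀ {n} → 0 < n → ∃[ L ] (0 < L × n < 2 ^ L × 2 ^ L ≤ 2 * n)
  ∃-log {suc zero} _ = 1 , s≤s z≤n , s≤s (s≤s z≤n) , s≤s (s≤s z≤n)
  ∃-log {suc n@(suc _)} _ with L , 0<L , n< , ≤2n ← ∃-log {n} (s≤s z≤n) with suc n ℕP.<? 2 ^ L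
  ... | yes n+1< = L , 0<L , n+1< , ℕP.≤-trans ≤2n (ℕP.*-monoʳ-≤ 2 (ℕP.n≤1+n n))
  ... | no n+1≮ = suc L , s≤s z≤n
    , ℕP.≤-<-trans n< (ℕP.^-monoʳ-< 2 (s≤s (s≤s z≤n)) (ℕP.n<1+n L))
    , ℕP.*-monoʳ-≤ 2 (ℕP.≮⇒≥ n+1≮)

  -- Serves to define a floor without dividing: the search goes down from m, and `Q 0` provides the
  -- default.
  largest : ∀ {Q : ℕ → Set} → Decidable Q → Q 0 → ∀ m → ∃[ b ] (Q b × (∀ d → d ≤ m → Q d → d ≤ b))
  largest Q? q0 zero = 0 , q0 , λ _ d≤0 _ → d≤0
  largest {Q} Q? q0 (suc m) with Q? (suc m)
  ... | yes q = suc m , q , λ _ d≤ _ → d≤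
  ... | no ¬q with b , qb , max ← largest Q? q0 m = b , qb , λ d d≤ qd →
    max d (ℕP.≤-pred (ℕP.≤∧≢⇒< d≤ λ { refl → ¬q qd })) qd

  ≤maxL : ∀ X → All (_≤ maxL X) X
  ≤maxL []      = []
  ≤maxL (x ∷ X) = ℕP.m≤m⊔n x _ ∷ All.map (λ le → ℕP.≤-trans le (ℕP.m≤n⊔m x _)) (≤maxL X)

  maxL-pos : ∀ {X} → 0 < length X → All (0 <_) X → 0 < maxL X
  maxL-pos {x ∷ X} _ (0<x ∷ _) = ℕP.≤-trans 0<x (ℕP.m≤m⊔n x _)

  mult-pos : ∀ X → 0 < length X → 0 < mult X
  mult-pos (x ∷ X) _ = ℕP.≤-trans
    (subst (λ Y → 0 < length Y) (sym (filter-accept (ℕ._≟ x) {xs = X} refl)) (s≤s z≤n))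
    (ℕP.m≤m⊔n (count x (x ∷ X)) _)

  sum-≤ : ∀ {M X} → All (_≤ M) X → sum X ≤ length X * M
  sum-≤ []           = z≤n
  sum-≤ (x≤M ∷ X≤M) = ℕP.+-mono-≤ x≤M (sum-≤ X≤M)

  sum-pos : ∀ {X} → 0 < length X → All (0 <_) X → 0 < sum X
  sum-pos {x ∷ X} _ (0<x ∷ _) = ℕP.≤-trans 0<x (ℕP.m≤m+n x _)

-- The embedding of ℕ in ℚ.

open Combinatorics
open import Data.Rational as ℚ using (ℚ; mkℚ; _+_; _*_; _/_; _≤_; *≤*; 0ℚ; 1ℚ; Positive; NonNegative; positive; nonNegative; toℚᵘ)
open import Data.Rational.Properties
open import Data.Rational.Solver using (module +-*-Solver)
open +-*-Solver using (solve; _:+_; _:*_; _:=_; con)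

-- For a variable n, `toℚ n` is stuck on the normalisation inside `_/_`; rewriting by this explicit
-- fraction lets numerators and denominators compute.
toℚ-mkℚ : ∀ n → toℚ n ≡ mkℚ (ℤ.+ n) 0 (Coprimality.sym (Coprimality.1-coprimeTo n))
toℚ-mkℚ n = normalize-coprime (Coprimality.sym (Coprimality.1-coprimeTo n))

toℚᵘ-toℚ : ∀ n → toℚᵘ (toℚ n) ≡ ℚᵘ.mkℚᵘ (ℤ.+ n) 0
toℚᵘ-toℚ n rewrite toℚ-mkℚ n = refl

toℚ-+ : ∀ m n → toℚ (m ℕ.+ n) ≡ toℚ m + toℚ n
toℚ-+ m n = toℚᵘ-injective (begin-equality
  toℚᵘ (toℚ (m ℕ.+ n))                              ≡⟨ toℚᵘ-toℚ (m ℕ.+ n) ⟩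
  ℚᵘ.mkℚᵘ (ℤ.+ (m ℕ.+ n)) 0                         ≃⟨ ℚᵘ.*≡* (cong (ℤ._* ℤ.1ℤ)
    (sym (cong₂ ℤ._+_ (ℤP.*-identityʳ (ℤ.+ m)) (ℤP.*-identityʳ (ℤ.+ n))))) ⟩
  ℚᵘ.mkℚᵘ (ℤ.+ m) 0 ℚᵘ.+ ℚᵘ.mkℚᵘ (ℤ.+ n) 0          ≡⟨ cong₂ ℚᵘ._+_ (toℚᵘ-toℚ m) (toℚᵘ-toℚ n) ⟨
  toℚᵘ (toℚ m) ℚᵘ.+ toℚᵘ (toℚ n)                    ≃⟨ toℚᵘ-homo-+ (toℚ m) (toℚ n) ⟨
  toℚᵘ (toℚ m + toℚ n)                              ∎)
  where open ℚᵘP.≤-Reasoning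

toℚ-* : ∀ m n → toℚ (m ℕ.* n) ≡ toℚ m * toℚ n
toℚ-* m n = toℚᵘ-injective (begin-equality
  toℚᵘ (toℚ (m ℕ.* n))                              ≡⟨ toℚᵘ-toℚ (m ℕ.* n) ⟩
  ℚᵘ.mkℚᵘ (ℤ.+ (m ℕ.* n)) 0                         ≃⟨ ℚᵘ.*≡* (cong (ℤ._* ℤ.1ℤ) (ℤP.pos-* m n)) ⟩
  ℚᵘ.mkℚᵘ (ℤ.+ m) 0 ℚᵘ.* ℚᵘ.mkℚᵘ (ℤ.+ n) 0          ≡⟨ cong₂ ℚᵘ._*_ (toℚᵘ-toℚ m) (toℚᵘ-toℚ n) ⟨
  toℚᵘ (toℚ m) ℚᵘ.* toℚᵘ (toℚ n)                    ≃⟨ toℚᵘ-homo-* (toℚ m) (toℚ n) ⟨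
  toℚᵘ (toℚ m * toℚ n)                              ∎)
  where open ℚᵘP.≤-Reasoning

toℚ-mono-≤ : ∀ {m n} → m ℕ.≤ n → toℚ m ≤ toℚ n
toℚ-mono-≤ {m} {n} m≤n rewrite toℚ-mkℚ m | toℚ-mkℚ n =
  *≤* (ℤP.*-monoʳ-≤-nonNeg ℤ.1ℤ (ℤ.+≤+ m≤n))

toℚ-cancel-≤ : ∀ {m n} → toℚ m ≤ toℚ n → m ℕ.≤ n
toℚ-cancel-≤ {m} {n} p rewrite toℚ-mkℚ m | toℚ-mkℚ n =
  ℤP.drop‿+≤+ (ℤP.*-cancelʳ-≤-pos _ _ ℤ.1ℤ (drop-*≤* p))

toℚ-cancel-< : ∀ {m n} → toℚ m ℚ.< toℚ n → m ℕ.< n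
toℚ-cancel-< {m} {n} p = ℕP.≰⇒> λ n≤m → <-irrefl refl (<-≤-trans p (toℚ-mono-≤ n≤m))

toℚ-nonNeg : ∀ n → NonNegative (toℚ n)
toℚ-nonNeg n = nonNegative (toℚ-mono-≤ {0} {n} z≤n)

toℚ-pos : ∀ {n} → 0 < n → Positive (toℚ n)
toℚ-pos {n} 0<n = positive (≰⇒> λ p → ℕP.<⇒≱ 0<n (toℚ-cancel-≤ {n} {0} p))

suc*recip : ∀ k → toℚ (suc k) * (ℤ.+ 1 / suc k) ≡ 1ℚ
suc*recip k = trans
  (cong₂ _*_ (toℚ-mkℚ (suc k)) (normalize-coprime (Coprimality.1-coprimeTo (suc k))))
  (*-inverseʳ (mkℚ (ℤ.+ suc k) 0 (Coprimality.sym (Coprimality.1-coprimeTo (suc k)))))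

recip-nonNeg : ∀ k → NonNegative (ℤ.+ 1 / suc k)
recip-nonNeg k = nonNegative (subst (0ℚ ≤_)
  (sym (normalize-coprime (Coprimality.1-coprimeTo (suc k))))
  (*≤* (ℤ.+≤+ z≤n)))

*-mono-≤-nonNeg : ∀ {p q r s} → .{{NonNegative p}} → .{{NonNegative s}} → p ≤ q → r ≤ s → p * r ≤ q * s
*-mono-≤-nonNeg {p} {q} {r} {s} p≤q r≤s =
  ≤-trans (*-monoˡ-≤-nonNeg p r≤s) (*-monoʳ-≤-nonNeg s p≤q)

-- Partial sums of the exponential series.

expTerm-nonNeg : ∀ t .{{_ : NonNegative t}} k → NonNegative (expTerm t k)
expTerm-nonNeg t zero    = _
expTerm-nonNeg t (suc k) =
  nonNeg*nonNeg⇒nonNeg (expTerm t k * t)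
    {{nonNeg*nonNeg⇒nonNeg (expTerm t k) {{expTerm-nonNeg t k}} t}}
    (ℤ.+ 1 / suc k) {{recip-nonNeg k}}

expPartial-nonNeg : ∀ t .{{_ : NonNegative t}} N → NonNegative (expPartial t N)
expPartial-nonNeg t zero    = _
expPartial-nonNeg t (suc N) =
  nonNeg+nonNeg⇒nonNeg (expPartial t N) {{expPartial-nonNeg t N}}
    (expTerm t (suc N)) {{expTerm-nonNeg t (suc N)}}

expTerm-mono-≤ : ∀ {s t} → .{{NonNegative s}} → .{{NonNegative t}} → s ≤ t → ∀ k → expTerm s k ≤ expTerm t k
expTerm-mono-≤ s≤t zero = ≤-refl
expTerm-mono-≤ {s} {t} s≤t (suc k) = *-monoʳ-≤-nonNeg (ℤ.+ 1 / suc k) {{recip-nonNeg k}}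
  (*-mono-≤-nonNeg {{expTerm-nonNeg s k}} (expTerm-mono-≤ s≤t k) s≤t)

expPartial-mono-≤ : ∀ {s t} → .{{NonNegative s}} → .{{NonNegative t}} → s ≤ t → ∀ N → expPartial s N ≤ expPartial t N
expPartial-mono-≤ s≤t zero    = ≤-refl
expPartial-mono-≤ s≤t (suc N) = +-mono-≤ (expPartial-mono-≤ s≤t N) (expTerm-mono-≤ s≤t (suc N))

suc*expTerm : ∀ t k → toℚ (suc k) * expTerm t (suc k) ≡ expTerm t k * t
suc*expTerm t k = begin-equality
  toℚ (suc k) * (expTerm t k * t * r)  ≡⟨ solve 3 (λ c a r → c :* (a :* r) := (c :* r) :* a) refl (toℚ (suc k)) (expTerm t k * t) r ⟩
  toℚ (suc k) * r * (expTerm t k * t)  ≡⟨ cong (_* (expTerm t k * t)) (suc*recip k) ⟩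
  1ℚ * (expTerm t k * t)               ≡⟨ *-identityˡ _ ⟩
  expTerm t k * t                      ∎
  where
  open ≤-Reasoning
  r = ℤ.+ 1 / suc k

-- The mean value estimate yᵏ⁺¹ − xᵏ⁺¹ ≤ (k + 1) (y − x) yᵏ at y = x + u.
expTerm-+-≤ : ∀ x u .{{_ : NonNegative x}} .{{_ : NonNegative u}} k →
  expTerm (x + u) (suc k) ≤ expTerm x (suc k) + u * expTerm (x + u) k
expTerm-+-≤ x u zero = ≤-reflexive
  (solve 2 (λ x u → con 1ℚ :* (x :+ u) :* con 1ℚ := con 1ℚ :* x :* con 1ℚ :+ u :* con 1ℚ) refl x u)
expTerm-+-≤ x u (suc k) = begin
  T₁y * (x + u) * r
    ≡⟨ solve 4 (λ a x u r → a :* (x :+ u) :* r := (a :* x :+ u :* a) :* r) refl T₁y x u r ⟩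
  (T₁y * x + u * T₁y) * r
    ≤⟨ *-monoʳ-≤-nonNeg r (+-monoˡ-≤ (u * T₁y) (*-monoʳ-≤-nonNeg x (expTerm-+-≤ x u k))) ⟩
  ((T₁x + u * T₀y) * x + u * T₁y) * r
    ≡⟨ solve 6 (λ a b c x u r → ((b :+ u :* c) :* x :+ u :* a) :* r := b :* x :* r :+ u :* (a :+ c :* x) :* r) refl T₁y T₁x T₀y x u r ⟩
  T₁x * x * r + u * (T₁y + T₀y * x) * r
    -- Raising T₀y x to T₀y (x + u) = (k + 1) T₁y turns the bracket into (k + 2) T₁y, and the factor
    -- k + 2 cancels against r.
    ≤⟨ +-monoʳ-≤ (T₁x * x * r) (*-monoʳ-≤-nonNeg r (*-monoˡ-≤-nonNeg u (+-monoʳ-≤ T₁y (*-monoˡ-≤-nonNeg T₀y x≤x+u)))) ⟩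
  T₁x * x * r + u * (T₁y + T₀y * (x + u)) * r
    ≡⟨ cong (λ z → T₁x * x * r + u * (T₁y + z) * r) (suc*expTerm (x + u) k) ⟨
  T₁x * x * r + u * (T₁y + toℚ (suc k) * T₁y) * r
    ≡⟨ solve 5 (λ e a u c r → e :+ u :* (a :+ c :* a) :* r := e :+ (con 1ℚ :+ c) :* r :* (u :* a)) refl (T₁x * x * r) T₁y u (toℚ (suc k)) r ⟩
  T₁x * x * r + (1ℚ + toℚ (suc k)) * r * (u * T₁y)
    ≡⟨ cong (λ z → T₁x * x * r + z * (u * T₁y)) (trans (cong (_* r) (sym (toℚ-+ 1 (suc k)))) (suc*recip (suc k))) ⟩
  T₁x * x * r + 1ℚ * (u * T₁y)
    ≡⟨ cong (T₁x * x * r +_) (*-identityˡ _) ⟩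
  T₁x * x * r + u * T₁y ∎
  where
  open ≤-Reasoning
  T₁y = expTerm (x + u) (suc k)
  T₀y = expTerm (x + u) k
  T₁x = expTerm x (suc k)
  r = ℤ.+ 1 / suc (suc k)
  instance
    _ : NonNegative r
    _ = recip-nonNeg (suc k)
    _ : NonNegative T₀y
    _ = expTerm-nonNeg (x + u) {{nonNeg+nonNeg⇒nonNeg x u}} k
  x≤x+u : x ≤ x + u
  x≤x+u = subst (_≤ x + u) (+-identityʳ x) (+-monoʳ-≤ x (nonNegative⁻¹ u))

-- The truncated form of e^(x+u) - e^x ≤ u e^(x+u), obtained by summing `expTerm-+-≤`. The last sum
-- stops at N because the constant terms agree and every other term is bounded through its
-- predecessor.
expPartial-+-≤ : ∀ x u .{{_ : NonNegative x}} .{{_ : NonNegative u}} N →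
  expPartial (x + u) (suc N) ≤ expPartial x (suc N) + u * expPartial (x + u) N
expPartial-+-≤ x u zero = subst (1ℚ + expTerm (x + u) 1 ≤_) (sym (+-assoc 1ℚ (expTerm x 1) (u * 1ℚ)))
  (+-monoʳ-≤ 1ℚ (expTerm-+-≤ x u 0))
expPartial-+-≤ x u (suc N) = begin
  expPartial (x + u) (suc N) + expTerm (x + u) (2 ℕ.+ N)
    ≤⟨ +-mono-≤ (expPartial-+-≤ x u N) (expTerm-+-≤ x u (suc N)) ⟩
  (expPartial x (suc N) + u * expPartial (x + u) N) + (expTerm x (2 ℕ.+ N) + u * expTerm (x + u) (suc N))
    ≡⟨ solve 5 (λ a b c d u → (a :+ u :* b) :+ (c :+ u :* d) := (a :+ c) :+ u :* (b :+ d)) refl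
         (expPartial x (suc N)) (expPartial (x + u) N) (expTerm x (2 ℕ.+ N)) (expTerm (x + u) (suc N)) u ⟩
  expPartial x (2 ℕ.+ N) + u * expPartial (x + u) (suc N) ∎
  where open ≤-Reasoning

-- The increment 5/8 is made in four steps of 5/32, each costing a factor 1 / (1 - 5/32) = 32/27.
-- Four steps give (32/27)⁴ < 2, whereas three steps of 5/24 would give (24/19)³ > 2.
5/32 27/32 32/27 5/8 : ℚ
5/32  = ℤ.+ 5 / 32
27/32 = ℤ.+ 27 / 32
32/27 = ℤ.+ 32 / 27
5/8   = ℤ.+ 5 / 8

-- With E(y) for the partial sum at y = x + 5/32, `expPartial-+-≤` and the non-negativity of the
-- last term give E(y) ≤ E(x) + 5/32 E(y); this is solved for E(y).
expPartial-step : ∀ x .{{_ : NonNegative x}} N → expPartial (x + 5/32) N ≤ 32/27 * expPartial x N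
expPartial-step x zero    = ≤ᵇ⇒≤ _
expPartial-step x (suc N) = *-cancelˡ-≤-pos 27/32 (begin
  27/32 * Ey
    ≡⟨ solve 1 (λ e → con 27/32 :* e := con (ℤ.- ℤ.+ 5 / 32) :* e :+ e) refl Ey ⟩
  (ℤ.- ℤ.+ 5 / 32) * Ey + Ey
    ≤⟨ +-monoʳ-≤ ((ℤ.- ℤ.+ 5 / 32) * Ey) (≤-trans (expPartial-+-≤ x 5/32 N) (+-monoʳ-≤ Ex (*-monoˡ-≤-nonNeg 5/32 E-mono))) ⟩
  (ℤ.- ℤ.+ 5 / 32) * Ey + (Ex + 5/32 * Ey)
    ≡⟨ solve 2 (λ e f → con (ℤ.- ℤ.+ 5 / 32) :* e :+ (f :+ con 5/32 :* e) := con 27/32 :* (con 32/27 :* f)) refl Ey Ex ⟩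
  27/32 * (32/27 * Ex) ∎)
  where
  open ≤-Reasoning
  Ey = expPartial (x + 5/32) (suc N)
  Ex = expPartial x (suc N)
  instance
    _ : NonNegative (x + 5/32)
    _ = nonNeg+nonNeg⇒nonNeg x 5/32
    _ : NonNegative (expTerm (x + 5/32) (suc N))
    _ = expTerm-nonNeg (x + 5/32) (suc N)
  E-mono : expPartial (x + 5/32) N ≤ Ey
  E-mono = subst (_≤ Ey) (+-identityʳ (expPartial (x + 5/32) N)) (+-monoʳ-≤ (expPartial (x + 5/32) N) (nonNegative⁻¹ (expTerm (x + 5/32) (suc N))))

-- e^(5/8) ≤ (1 − 5/32)⁻⁴ ≤ 2.
expPartial-double : ∀ x .{{_ : NonNegative x}} N → expPartial (x + 5/8) N ≤ toℚ 2 * expPartial x N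
expPartial-double x N = begin
  expPartial (x + 5/8) N
    ≡⟨ cong (λ z → expPartial z N) (solve 1 (λ x → x :+ con 5/8 := x :+ con 5/32 :+ con 5/32 :+ con 5/32 :+ con 5/32) refl x) ⟩
  expPartial (x₃ + 5/32) N                               ≤⟨ expPartial-step x₃ N ⟩
  32/27 * expPartial x₃ N                                ≤⟨ *-monoˡ-≤-nonNeg 32/27 (expPartial-step x₂ N) ⟩
  32/27 * (32/27 * expPartial x₂ N)                      ≤⟨ *-monoˡ-≤-nonNeg 32/27 (*-monoˡ-≤-nonNeg 32/27 (expPartial-step x₁ N)) ⟩
  32/27 * (32/27 * (32/27 * expPartial x₁ N))            ≤⟨ *-monoˡ-≤-nonNeg 32/27 (*-monoˡ-≤-nonNeg 32/27 (*-monoˡ-≤-nonNeg 32/27 (expPartial-step x N))) ⟩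
  32/27 * (32/27 * (32/27 * (32/27 * expPartial x N)))   ≡⟨ solve 1 (λ e → con 32/27 :* (con 32/27 :* (con 32/27 :* (con 32/27 :* e))) := con (32/27 * 32/27 * 32/27 * 32/27) :* e) refl (expPartial x N) ⟩
  32/27 * 32/27 * 32/27 * 32/27 * expPartial x N         ≤⟨ *-monoʳ-≤-nonNeg (expPartial x N) {{expPartial-nonNeg x N}} {32/27 * 32/27 * 32/27 * 32/27} {toℚ 2} (≤ᵇ⇒≤ _) ⟩
  toℚ 2 * expPartial x N                                 ∎
  where
  open ≤-Reasoning
  x₁ = x + 5/32
  x₂ = x₁ + 5/32
  x₃ = x₂ + 5/32
  instance
    _ : NonNegative x₁
    _ = nonNeg+nonNeg⇒nonNeg x 5/32
    _ : NonNegative x₂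
    _ = nonNeg+nonNeg⇒nonNeg x₁ 5/32
    _ : NonNegative x₃
    _ = nonNeg+nonNeg⇒nonNeg x₂ 5/32

expPartial-0 : ∀ N → expPartial 0ℚ N ≡ 1ℚ
expPartial-0 zero    = refl
expPartial-0 (suc N) = begin-equality
  expPartial 0ℚ N + expTerm 0ℚ N * 0ℚ * (ℤ.+ 1 / suc N)
    ≡⟨ solve 3 (λ e a r → e :+ a :* con 0ℚ :* r := e) refl (expPartial 0ℚ N) (expTerm 0ℚ N) (ℤ.+ 1 / suc N) ⟩
  expPartial 0ℚ N ≡⟨ expPartial-0 N ⟩
  1ℚ ∎
  where open ≤-Reasoning

-- Comparison of logarithms with powers of two.

expPartial-pow2 : ∀ L N → expPartial (toℚ L * 5/8) N ≤ toℚ (2 ℕ.^ L)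
expPartial-pow2 zero    N = ≤-reflexive (expPartial-0 N)
expPartial-pow2 (suc L) N = begin
  expPartial (toℚ (suc L) * 5/8) N
    ≡⟨ cong (λ z → expPartial z N) (trans (cong (_* 5/8) (toℚ-+ 1 L)) (solve 1 (λ l → (con 1ℚ :+ l) :* con 5/8 := l :* con 5/8 :+ con 5/8) refl (toℚ L))) ⟩
  expPartial (toℚ L * 5/8 + 5/8) N     ≤⟨ expPartial-double (toℚ L * 5/8) {{nonNeg*nonNeg⇒nonNeg (toℚ L) {{toℚ-nonNeg L}} 5/8}} N ⟩
  toℚ 2 * expPartial (toℚ L * 5/8) N   ≤⟨ *-monoˡ-≤-nonNeg (toℚ 2) (expPartial-pow2 L N) ⟩
  toℚ 2 * toℚ (2 ℕ.^ L)                ≡⟨ toℚ-* 2 (2 ℕ.^ L) ⟨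
  toℚ (2 ℕ.^ suc L)                    ∎
  where open ≤-Reasoning

-- Cancelling c > 0 gives 0 ≤ t ≤ 5 L / 8. The partial sums are monotone on non-negative arguments,
-- so at t they are at most their value at 5 L / 8, hence at most 2ᴸ.
LeMulLn-pow2 : ∀ {a c m} L .{{_ : Positive c}} → 0ℚ ≤ a →
  a ≤ toℚ L * 5/8 * c → 2 ℕ.^ L ℕ.≤ m → LeMulLn a c m
LeMulLn-pow2 {a} {c} {m} L 0≤a a≤ 2^L≤m t tc≡a N = ≤-trans
  (expPartial-mono-≤ {{nonNegative 0≤t}} {{nonNeg*nonNeg⇒nonNeg (toℚ L) {{toℚ-nonNeg L}} 5/8}} t≤ N)
  (≤-trans (expPartial-pow2 L N) (toℚ-mono-≤ 2^L≤m))
  where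
  0≤t : 0ℚ ≤ t
  0≤t = *-cancelʳ-≤-pos c (subst₂ _≤_ (sym (*-zeroˡ c)) (sym tc≡a) 0≤a)
  t≤ : t ≤ toℚ L * 5/8
  t≤ = *-cancelʳ-≤-pos c (subst (_≤ toℚ L * 5/8 * c) (sym tc≡a) a≤)

-- 5 L w δ ≤ 5 L α s = (5 L / 8) · 8 α s, and 5 L / 8 ≤ ln 2ᴸ.
LeMulLn-scaled : ∀ {δ α} .{{_ : NonNegative δ}} .{{_ : Positive α}} r w s {L m} → 0 < s →
  r ℕ.≤ 5 ℕ.* L ℕ.* w → toℚ w * δ ≤ α * toℚ s → 2 ℕ.^ L ℕ.≤ m →
  LeMulLn (toℚ r * δ) (toℚ s * toℚ 8 * α) m
LeMulLn-scaled {δ} {α} r w s {L} 0<s r≤ wδ≤αs = LeMulLn-pow2 L {{c>0}}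
  (nonNegative⁻¹ (toℚ r * δ) {{nonNeg*nonNeg⇒nonNeg (toℚ r) {{toℚ-nonNeg r}} δ}}) (begin
    toℚ r * δ                           ≤⟨ *-monoʳ-≤-nonNeg δ (toℚ-mono-≤ r≤) ⟩
    toℚ (5 ℕ.* L ℕ.* w) * δ             ≡⟨ cong (_* δ) (trans (toℚ-* (5 ℕ.* L) w) (cong (_* toℚ w) (toℚ-* 5 L))) ⟩
    toℚ 5 * toℚ L * toℚ w * δ           ≡⟨ *-assoc (toℚ 5 * toℚ L) (toℚ w) δ ⟩
    toℚ 5 * toℚ L * (toℚ w * δ)         ≤⟨ *-monoˡ-≤-nonNeg (toℚ 5 * toℚ L) {{nonNeg*nonNeg⇒nonNeg (toℚ 5) (toℚ L) {{toℚ-nonNeg L}}}} wδ≤αs ⟩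
    toℚ 5 * toℚ L * (α * toℚ s)         ≡⟨ solve 3 (λ l a s → con (toℚ 5) :* l :* (a :* s) := l :* con 5/8 :* (s :* con (toℚ 8) :* a)) refl (toℚ L) α (toℚ s) ⟩
    toℚ L * 5/8 * (toℚ s * toℚ 8 * α)   ∎)
  where
  open ≤-Reasoning
  c>0 : Positive (toℚ s * toℚ 8 * α)
  c>0 = pos*pos⇒pos (toℚ s * toℚ 8) {{pos*pos⇒pos (toℚ s) {{toℚ-pos 0<s}} (toℚ 8)}} α

-- Choice of b, and the bounds that density yields.

theorem4p12 : (δ α : ℚ) → 1ℚ ≤ δ → 1ℚ ≤ α →
    (X : List ℕ) → 0 < length X → All (0 <_) X →
    Dense δ X →
    (∀ d → ¬ AlmostDivisor α X d) →
    Σ[ R ∈ List ℕ ] (R ⊆ X)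
    × LeMulLn (toℚ (length R) * δ) (toℚ (length X) * toℚ 8 * α) (2 ℕ.* length X)
    × LeMulLn (toℚ (Defs.Σ R) * δ) (toℚ (Defs.Σ X) * toℚ 8 * α) (2 ℕ.* length X)
    × (∀ (d : ℕ) → 1 < d →
    toℚ d * toℚ (length X ℕ.* length X) ≤ α * toℚ (mult X) * toℚ (Defs.Σ X) →
    d ℕ.≤ length (nonMultiples d R))
theorem4p12 δ α 1≤δ 1≤α X 0<n 0<X dense noDivisor =
  let L , 0<L , n<2^L , 2^L≤2n = ∃-log 0<n
      -- This b is ⌊α μ Σ(X) / n²⌋. Searching up to n loses nothing: by `d≤n`, any d > 1 satisfying
      -- `Small` is at most n.
      b , small-b , b-max = largest small? small-0 n
      R , R⊆X , |R|≤ , good = selection b L 0<L 0<X (≤maxL X) (M<2^2L L n<2^L)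
        (λ p 1<p → ℕP.<⇒≤ (small⇒< {b} small-b 1<p))
  in R , R⊆X
  -- Both size bounds have the same shape: b is weighed against n for the cardinality, and b M
  -- against Σ(X) for the sum.
  , LeMulLn-scaled (length R) b n {L} 0<n |R|≤ (bδ≤αn b small-b) 2^L≤2n
  , LeMulLn-scaled (Defs.Σ R) (b ℕ.* M) S {L} (sum-pos 0<n 0<X) (ΣR≤ {R} {L} {b} R⊆X |R|≤) (bMδ≤αS b small-b) 2^L≤2n
  , λ d 1<d small-d → good d 1<d (b-max d (d≤n 1<d small-d) small-d)
  where
  n = length X
  n² = n ℕ.* n
  μ = mult X
  S = Defs.Σ X
  M = maxL X
  0<M = maxL-pos 0<n 0<X
  instance
    _ : Positive δ
    _ = positive (<-≤-trans (positive⁻¹ 1ℚ) 1≤δ)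
    _ : Positive α
    _ = positive (<-≤-trans (positive⁻¹ 1ℚ) 1≤α)
    _ : NonNegative δ
    _ = pos⇒nonNeg δ
    _ : NonNegative α
    _ = pos⇒nonNeg α
    _ : NonNegative (toℚ μ)
    _ = toℚ-nonNeg μ
    _ : NonNegative (toℚ S)
    _ = toℚ-nonNeg S
    _ : NonNegative (toℚ M)
    _ = toℚ-nonNeg M
    _ : NonNegative (toℚ n²)
    _ = toℚ-nonNeg n²
    _ : NonNegative (α * toℚ μ)
    _ = nonNeg*nonNeg⇒nonNeg α (toℚ μ)
    _ : NonNegative (α * toℚ S)
    _ = nonNeg*nonNeg⇒nonNeg α (toℚ S)
    _ : NonNegative (toℚ M * δ)
    _ = nonNeg*nonNeg⇒nonNeg (toℚ M) δ
    _ : Positive (toℚ n²)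
    _ = toℚ-pos (ℕP.*-mono-≤ 0<n 0<n)
    _ : Positive (toℚ M)
    _ = toℚ-pos 0<M

  Small : ℕ → Set
  Small d = toℚ d * toℚ n² ≤ α * toℚ μ * toℚ S

  small? : ∀ d → Dec (Small d)
  small? d = toℚ d * toℚ n² ≤? α * toℚ μ * toℚ S

  small-0 : Small 0
  small-0 = subst (_≤ α * toℚ μ * toℚ S) (sym (*-zeroˡ (toℚ n²)))
    (nonNegative⁻¹ _ {{nonNeg*nonNeg⇒nonNeg (α * toℚ μ) (toℚ S)}})

  -- As d is not an almost divisor, n² times its number of non-multiples exceeds α μ Σ(X), which is
  -- at least k n².
  small⇒< : ∀ {k d} → Small k → 1 < d → k < length (nonMultiples d X)
  small⇒< {k} {d} small-k 1<d = toℚ-cancel-< (*-cancelʳ-<-nonNeg (toℚ n²)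
    (≤-<-trans small-k (≰⇒> λ le → noDivisor d (1<d , le))))

  d≤n : ∀ {d} → 1 < d → Small d → d ℕ.≤ n
  d≤n {d} 1<d small-d = ℕP.≤-trans (ℕP.<⇒≤ (small⇒< small-d 1<d)) (length-filter (d ∤?_) X)

  -- Density with δ ≥ 1 and μ ≥ 1. This puts the entries of X below 2^(2L), the range in which the
  -- bad primes are counted.
  M≤n² : M ℕ.≤ n²
  M≤n² = toℚ-cancel-≤ (begin
    toℚ M              ≡⟨ *-identityˡ (toℚ M) ⟨
    1ℚ * 1ℚ * toℚ M    ≤⟨ *-monoʳ-≤-nonNeg (toℚ M) (*-mono-≤-nonNeg 1≤δ (toℚ-mono-≤ {1} {μ} (mult-pos X 0<n))) ⟩
    δ * toℚ μ * toℚ M  ≤⟨ dense ⟩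
    toℚ n²             ∎)
    where open ≤-Reasoning

  M<2^2L : ∀ L → n < 2 ℕ.^ L → M < 2 ℕ.^ (2 ℕ.* L)
  M<2^2L L n< = ℕP.≤-<-trans M≤n² (subst (n² <_)
    (trans (sym (ℕP.^-distribˡ-+-* 2 L L)) (cong (λ k → 2 ℕ.^ (L ℕ.+ k)) (sym (ℕP.+-identityʳ L))))
    (ℕP.*-mono-< n< n<))

  -- Multiply b n² ≤ α μ Σ(X) by M δ; density replaces δ μ M by n², which then cancels.
  bMδ≤αS : ∀ b → Small b → toℚ (b ℕ.* M) * δ ≤ α * toℚ S
  bMδ≤αS b small-b = *-cancelʳ-≤-pos (toℚ n²) (begin
    toℚ (b ℕ.* M) * δ * toℚ n²             ≡⟨ cong (λ z → z * δ * toℚ n²) (toℚ-* b M) ⟩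
    toℚ b * toℚ M * δ * toℚ n²             ≡⟨ solve 4 (λ b m d n → b :* m :* d :* n := b :* n :* (m :* d)) refl (toℚ b) (toℚ M) δ (toℚ n²) ⟩
    toℚ b * toℚ n² * (toℚ M * δ)           ≤⟨ *-monoʳ-≤-nonNeg (toℚ M * δ) small-b ⟩
    α * toℚ μ * toℚ S * (toℚ M * δ)        ≡⟨ solve 5 (λ a u s m d → a :* u :* s :* (m :* d) := a :* s :* (d :* u :* m)) refl α (toℚ μ) (toℚ S) (toℚ M) δ ⟩
    α * toℚ S * (δ * toℚ μ * toℚ M)        ≤⟨ *-monoˡ-≤-nonNeg (α * toℚ S) dense ⟩
    α * toℚ S * toℚ n²                     ∎)
    where open ≤-Reasoning

  -- The previous bound divided by M, after Σ(X) ≤ n M.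
  bδ≤αn : ∀ b → Small b → toℚ b * δ ≤ α * toℚ n
  bδ≤αn b small-b = *-cancelʳ-≤-pos (toℚ M) (begin
    toℚ b * δ * toℚ M     ≡⟨ solve 3 (λ b d m → b :* d :* m := b :* m :* d) refl (toℚ b) δ (toℚ M) ⟩
    toℚ b * toℚ M * δ     ≡⟨ cong (_* δ) (toℚ-* b M) ⟨
    toℚ (b ℕ.* M) * δ     ≤⟨ bMδ≤αS b small-b ⟩
    α * toℚ S             ≤⟨ *-monoˡ-≤-nonNeg α (toℚ-mono-≤ (sum-≤ (≤maxL X))) ⟩
    α * toℚ (n ℕ.* M)     ≡⟨ cong (α *_) (toℚ-* n M) ⟩
    α * (toℚ n * toℚ M)   ≡⟨ *-assoc α (toℚ n) (toℚ M) ⟨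
    α * toℚ n * toℚ M     ∎)
    where open ≤-Reasoning

  ΣR≤ : ∀ {R L b} → R ⊆ X → length R ℕ.≤ 5 ℕ.* L ℕ.* b → Defs.Σ R ℕ.≤ 5 ℕ.* L ℕ.* (b ℕ.* M)
  ΣR≤ {R} {L} {b} R⊆X |R|≤ = begin
    Defs.Σ R                  ≤⟨ sum-≤ (All-resp-⊆ R⊆X (≤maxL X)) ⟩
    length R ℕ.* M            ≤⟨ ℕP.*-monoˡ-≤ M |R|≤ ⟩
    5 ℕ.* L ℕ.* b ℕ.* M       ≡⟨ ℕP.*-assoc (5 ℕ.* L) b M ⟩
    5 ℕ.* L ℕ.* (b ℕ.* M)     ∎
    where open ℕP.≤-Reasoning
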